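{- Let $f(z)=b(z)\prod_{i=0}^{\lfloor d/2\rfloor-1}(z^2+z+c_i)$ be a $CL$-polynomial of degree $d$, where (without loss of generality) the $c_i$ are ordered by size, $c_0\le c_1\le\cdots\le c_{\lfloor d/2\rfloor-1}$. Then $f$ satisfies $(\diamondsuit)$ if the $c_i$ satisfy $$c_i \leq \begin{cases}2i+2, & d\text{ is odd}, \\ 2i+1, & d\text{ is even}.\end{cases}$$
   Context: A $CL$-polynomial of degree $d$ is a polynomial of the form $f(z)=b(z)\prod_{i=0}^{\lfloor d/2\rfloor-1}(z^2+z+c_i)$, where the $c_i$ are real numbers $\geq\frac14$ and, for a non-zero constant $a$, $b(z)=a$ if $d$ is even and $b(z)=a(2z+1)$ if $d$ is odd. For a polynomial $f$ of degree $d$, the $h^*$-polynomial is the polynomial $h^*(t)=\sum_{i=0}^d h^*_i t^i$ with $\sum_{k\ge 0} f(k)t^k=\frac{h^*(t)}{(1-t)^{d+1}}$; equivalently $f(z)=\sum_{i=0}^d h_i^*\binom{z+d-i}{d}$. Property $(\diamondsuit)$ means that the coefficients of the $h^*$-polynomial of $f$ are palindromic (that is, $h^*_i=h^*_{d-i}$ for all $0\le i\le d$) and non-negative.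
   Formalization: The constant a in b(z) is assumed to be non-negative (hence positive, being non-zero), since for a < 0 the coefficients of the h*-polynomial cannot all be non-negative (e.g. d = 0, a = -1 gives h*_0 = -1). -}

module Defs where

open import Algebra.Bundles using (CommutativeMonoid)
import Algebra.Properties.CommutativeSemigroup as CommutativeSemigroupProperties
open import Data.Fin.Base as Fin using (Fin; toℕ; opposite)
import Data.Integer.Base as ℤ
open import Data.List.Base using (List; []; _∷_; map; foldr; applyUpTo; tabulate)
open import Data.Nat.Base as ℕ using (ℕ; zero; suc; _∸_; ⌊_/2⌋; parity)
import Data.Nat.Properties as ℕ
open import Data.Parity.Base using (0ℙ; 1ℙ)
open import Data.Product.Base using (_×_; _,_; ∃-syntax; proj₁; proj₂)
open import Data.Rational.Base as ℚ using (ℚ; 0ℚ; 1ℚ; ½)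
import Data.Rational.Properties as ℚ
open import Relation.Binary.PropositionalEquality using (_≡_; sym; trans; cong; cong₂; subst)
open import Relation.Nullary.Negation.Core using (¬_)

------------------------------------------------------------------------
-- Real numbers: Cauchy sequences of rationals with a modulus, taken up to
-- the setoid equality _≈_ below.  Operations are pointwise.

IsCauchy : (ℕ → ℚ) → Set
IsCauchy s = ∀ ε → 0ℚ ℚ.< ε → ∃[ N ] ∀ m n → N ℕ.≤ m → N ℕ.≤ n → ℚ.∣ s m ℚ.- s n ∣ ℚ.< ε

record ℝ : Set where
  constructor mkℝ
  field
    seq    : ℕ → ℚ
    cauchy : IsCauchy seq
open ℝ public

infix 4 _≈_ _≤_

_≈_ : ℝ → ℝ → Set
x ≈ y = ∀ ε → 0ℚ ℚ.< ε → ∃[ N ] ∀ n → N ℕ.≤ n → ℚ.∣ seq x n ℚ.- seq y n ∣ ℚ.< ε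

_≤_ : ℝ → ℝ → Set
x ≤ y = ∀ ε → 0ℚ ℚ.< ε → ∃[ N ] ∀ n → N ℕ.≤ n → seq x n ℚ.< seq y n ℚ.+ ε

module CauchyProperties where
  half-pos : ∀ {ε} → 0ℚ ℚ.< ε → 0ℚ ℚ.< ½ ℚ.* ε
  half-pos {ε} 0<ε = subst (ℚ._< ½ ℚ.* ε) (ℚ.*-zeroʳ ½) (ℚ.*-monoʳ-<-pos ½ 0<ε)

  half+half : ∀ ε → ½ ℚ.* ε ℚ.+ ½ ℚ.* ε ≡ ε
  half+half ε = trans (sym (ℚ.*-distribʳ-+ ε ½ ½)) (ℚ.*-identityˡ ε)

  const-cauchy : ∀ q → IsCauchy (λ _ → q)
  const-cauchy q ε 0<ε = 0 , λ _ _ _ _ →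
    subst (λ r → ℚ.∣ r ∣ ℚ.< ε) (sym (ℚ.+-inverseʳ q)) 0<ε

  neg-cauchy : ∀ {s} → IsCauchy s → IsCauchy (λ n → ℚ.- s n)
  neg-cauchy {s} cs ε 0<ε with cs ε 0<ε
  ... | N , bound = N , λ m n N≤m N≤n →
    subst (ℚ._< ε)
      (trans (sym (ℚ.∣-p∣≡∣p∣ (s m ℚ.- s n))) (cong ℚ.∣_∣ (ℚ.neg-distrib-+ (s m) (ℚ.- s n))))
      (bound m n N≤m N≤n)

  +-cauchy : ∀ {s t} → IsCauchy s → IsCauchy t → IsCauchy (λ n → s n ℚ.+ t n)
  +-cauchy {s} {t} cs ct ε 0<ε with cs (½ ℚ.* ε) (half-pos 0<ε) | ct (½ ℚ.* ε) (half-pos 0<ε)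
  ... | M , bs | N , bt = M ℕ.⊔ N , λ m n ≤m ≤n → begin-strict
      ℚ.∣ (s m ℚ.+ t m) ℚ.- (s n ℚ.+ t n) ∣
        ≡⟨ cong ℚ.∣_∣ (regroup (s m) (t m) (s n) (t n)) ⟩
      ℚ.∣ (s m ℚ.- s n) ℚ.+ (t m ℚ.- t n) ∣
        ≤⟨ ℚ.∣p+q∣≤∣p∣+∣q∣ (s m ℚ.- s n) (t m ℚ.- t n) ⟩
      ℚ.∣ s m ℚ.- s n ∣ ℚ.+ ℚ.∣ t m ℚ.- t n ∣
        <⟨ ℚ.+-mono-< (bs m n (ℕ.m⊔n≤o⇒m≤o M N ≤m) (ℕ.m⊔n≤o⇒m≤o M N ≤n))
                      (bt m n (ℕ.m⊔n≤o⇒n≤o M N ≤m) (ℕ.m⊔n≤o⇒n≤o M N ≤n)) ⟩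
      ½ ℚ.* ε ℚ.+ ½ ℚ.* ε
        ≡⟨ half+half ε ⟩
      ε ∎
    where
    open ℚ.≤-Reasoning
    open CommutativeSemigroupProperties
      (CommutativeMonoid.commutativeSemigroup ℚ.+-0-commutativeMonoid) using (interchange)
    regroup : ∀ a b c d → (a ℚ.+ b) ℚ.- (c ℚ.+ d) ≡ (a ℚ.- c) ℚ.+ (b ℚ.- d)
    regroup a b c d = trans (cong (a ℚ.+ b ℚ.+_) (ℚ.neg-distrib-+ c d))
                            (interchange a b (ℚ.- c) (ℚ.- d))

  split : ∀ a b → a ≡ (a ℚ.- b) ℚ.+ b
  split a b = sym (trans (ℚ.+-assoc a (ℚ.- b) b)
                  (trans (cong (a ℚ.+_) (ℚ.+-inverseˡ b)) (ℚ.+-identityʳ a)))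

  telescope : ∀ p q r → p ℚ.- r ≡ (p ℚ.- q) ℚ.+ (q ℚ.- r)
  telescope p q r = trans (cong (ℚ._- r) (split p q)) (ℚ.+-assoc (p ℚ.- q) q (ℚ.- r))

  *-distribˡ-- : ∀ a b c → a ℚ.* (b ℚ.- c) ≡ a ℚ.* b ℚ.- a ℚ.* c
  *-distribˡ-- a b c = trans (ℚ.*-distribˡ-+ a b (ℚ.- c))
                             (cong (a ℚ.* b ℚ.+_) (sym (ℚ.neg-distribʳ-* a c)))

  0<1 : 0ℚ ℚ.< 1ℚ
  0<1 = ℚ.positive⁻¹ 1ℚ

  eventually-bounded : ∀ {s} → IsCauchy s →
    ∃[ B ] 0ℚ ℚ.< B × ∃[ N ] ∀ n → N ℕ.≤ n → ℚ.∣ s n ∣ ℚ.≤ B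
  eventually-bounded {s} cs with cs 1ℚ 0<1
  ... | N , bound = 1ℚ ℚ.+ ℚ.∣ s N ∣ , ℚ.+-mono-<-≤ 0<1 (ℚ.0≤∣p∣ (s N)) , N , λ n N≤n → begin
      ℚ.∣ s n ∣
        ≡⟨ cong ℚ.∣_∣ (split (s n) (s N)) ⟩
      ℚ.∣ (s n ℚ.- s N) ℚ.+ s N ∣
        ≤⟨ ℚ.∣p+q∣≤∣p∣+∣q∣ (s n ℚ.- s N) (s N) ⟩
      ℚ.∣ s n ℚ.- s N ∣ ℚ.+ ℚ.∣ s N ∣
        ≤⟨ ℚ.+-monoˡ-≤ ℚ.∣ s N ∣ (ℚ.<⇒≤ (bound n N N≤n ℕ.≤-refl)) ⟩
      1ℚ ℚ.+ ℚ.∣ s N ∣ ∎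
    where
    open ℚ.≤-Reasoning

  *-cauchy : ∀ {s t} → IsCauchy s → IsCauchy t → IsCauchy (λ n → s n ℚ.* t n)
  *-cauchy {s} {t} cs ct ε 0<ε
    with eventually-bounded cs | eventually-bounded ct
  ... | B , 0<B , M , bs | C , 0<C , N , bt = K , close
    where
    open ℚ.≤-Reasoning
    D = B ℚ.+ C
    0<D : 0ℚ ℚ.< D
    0<D = ℚ.+-mono-< 0<B 0<C
    instance
      D-pos = ℚ.positive 0<D
      D≢0 = ℚ.pos⇒nonZero D
      D⁻¹-pos = ℚ.1/pos⇒pos D
      B-pos = ℚ.positive 0<B
      C-pos = ℚ.positive 0<C
    δ = ℚ.1/ D ℚ.* ε
    0<δ : 0ℚ ℚ.< δ
    0<δ = subst (ℚ._< δ) (ℚ.*-zeroʳ (ℚ.1/ D)) (ℚ.*-monoʳ-<-pos (ℚ.1/ D) 0<ε)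
    P = proj₁ (cs δ 0<δ)
    Q = proj₁ (ct δ 0<δ)
    K = (M ℕ.⊔ N) ℕ.⊔ (P ℕ.⊔ Q)

    regroup : ∀ a b c d → a ℚ.* b ℚ.- c ℚ.* d ≡ a ℚ.* (b ℚ.- d) ℚ.+ d ℚ.* (a ℚ.- c)
    regroup a b c d = trans (telescope (a ℚ.* b) (a ℚ.* d) (c ℚ.* d))
      (cong₂ ℚ._+_ (sym (*-distribˡ-- a b d))
        (trans (cong₂ ℚ._-_ (ℚ.*-comm a d) (ℚ.*-comm c d)) (sym (*-distribˡ-- d a c))))

    bounded-mult : ∀ {E} .{{_ : ℚ.Positive E}} u v →
      ℚ.∣ u ∣ ℚ.≤ E → ℚ.∣ v ∣ ℚ.< δ → ℚ.∣ u ℚ.* v ∣ ℚ.< E ℚ.* δ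
    bounded-mult {E} u v u≤E v<δ = begin-strict
      ℚ.∣ u ℚ.* v ∣         ≡⟨ ℚ.∣p*q∣≡∣p∣*∣q∣ u v ⟩
      ℚ.∣ u ∣ ℚ.* ℚ.∣ v ∣   ≤⟨ ℚ.*-monoʳ-≤-nonNeg ℚ.∣ v ∣ {{ℚ.nonNegative (ℚ.0≤∣p∣ v)}} u≤E ⟩
      E ℚ.* ℚ.∣ v ∣         <⟨ ℚ.*-monoʳ-<-pos E v<δ ⟩
      E ℚ.* δ               ∎

    close : ∀ m n → K ℕ.≤ m → K ℕ.≤ n → ℚ.∣ s m ℚ.* t m ℚ.- s n ℚ.* t n ∣ ℚ.< ε
    close m n K≤m K≤n = begin-strict
      ℚ.∣ s m ℚ.* t m ℚ.- s n ℚ.* t n ∣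
        ≡⟨ cong ℚ.∣_∣ (regroup (s m) (t m) (s n) (t n)) ⟩
      ℚ.∣ s m ℚ.* (t m ℚ.- t n) ℚ.+ t n ℚ.* (s m ℚ.- s n) ∣
        ≤⟨ ℚ.∣p+q∣≤∣p∣+∣q∣ (s m ℚ.* (t m ℚ.- t n)) (t n ℚ.* (s m ℚ.- s n)) ⟩
      ℚ.∣ s m ℚ.* (t m ℚ.- t n) ∣ ℚ.+ ℚ.∣ t n ℚ.* (s m ℚ.- s n) ∣
        <⟨ ℚ.+-mono-<
             (bounded-mult (s m) (t m ℚ.- t n) (bs m (M≤ K≤m)) (proj₂ (ct δ 0<δ) m n (Q≤ K≤m) (Q≤ K≤n)))
             (bounded-mult (t n) (s m ℚ.- s n) (bt n (N≤ K≤n)) (proj₂ (cs δ 0<δ) m n (P≤ K≤m) (P≤ K≤n))) ⟩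
      B ℚ.* δ ℚ.+ C ℚ.* δ
        ≡⟨ sym (ℚ.*-distribʳ-+ δ B C) ⟩
      D ℚ.* (ℚ.1/ D ℚ.* ε)
        ≡⟨ sym (ℚ.*-assoc D (ℚ.1/ D) ε) ⟩
      (D ℚ.* ℚ.1/ D) ℚ.* ε
        ≡⟨ cong (ℚ._* ε) (ℚ.*-inverseʳ D) ⟩
      1ℚ ℚ.* ε
        ≡⟨ ℚ.*-identityˡ ε ⟩
      ε ∎
      where
      M≤ : ∀ {k} → K ℕ.≤ k → M ℕ.≤ k
      M≤ h = ℕ.m⊔n≤o⇒m≤o M N (ℕ.m⊔n≤o⇒m≤o (M ℕ.⊔ N) (P ℕ.⊔ Q) h)
      N≤ : ∀ {k} → K ℕ.≤ k → N ℕ.≤ k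
      N≤ h = ℕ.m⊔n≤o⇒n≤o M N (ℕ.m⊔n≤o⇒m≤o (M ℕ.⊔ N) (P ℕ.⊔ Q) h)
      P≤ : ∀ {k} → K ℕ.≤ k → P ℕ.≤ k
      P≤ h = ℕ.m⊔n≤o⇒m≤o P Q (ℕ.m⊔n≤o⇒n≤o (M ℕ.⊔ N) (P ℕ.⊔ Q) h)
      Q≤ : ∀ {k} → K ℕ.≤ k → Q ℕ.≤ k
      Q≤ h = ℕ.m⊔n≤o⇒n≤o P Q (ℕ.m⊔n≤o⇒n≤o (M ℕ.⊔ N) (P ℕ.⊔ Q) h)

open CauchyProperties using (+-cauchy; *-cauchy; neg-cauchy; const-cauchy)

infixl 6 _+_
infixl 7 _*_
infix  8 -_

_+_ : ℝ → ℝ → ℝ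
seq    (x + y) n = seq x n ℚ.+ seq y n
cauchy (x + y)   = +-cauchy {seq x} {seq y} (cauchy x) (cauchy y)

_*_ : ℝ → ℝ → ℝ
seq    (x * y) n = seq x n ℚ.* seq y n
cauchy (x * y)   = *-cauchy {seq x} {seq y} (cauchy x) (cauchy y)

-_ : ℝ → ℝ
seq    (- x) n = ℚ.- seq x n
cauchy (- x)   = neg-cauchy {seq x} (cauchy x)

fromℚ : ℚ → ℝ
fromℚ q = mkℝ (λ _ → q) (const-cauchy q)

fromℕ : ℕ → ℝ
fromℕ n = fromℚ (ℤ.+ n ℚ./ 1)

0ℝ 1ℝ ¼ : ℝ
0ℝ = fromℕ 0
1ℝ = fromℕ 1
¼  = fromℚ (ℤ.+ 1 ℚ./ 4)

------------------------------------------------------------------------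
-- Real polynomials as coefficient lists, constant term first; trailing
-- zeros are allowed.

Poly : Set
Poly = List ℝ

infixl 6 _+ₚ_
infixl 7 _*ₚ_
infixr 8 _^ₚ_

_+ₚ_ : Poly → Poly → Poly
[]      +ₚ q       = q
(x ∷ p) +ₚ []      = x ∷ p
(x ∷ p) +ₚ (y ∷ q) = x + y ∷ p +ₚ q

_*ₚ_ : Poly → Poly → Poly
[]      *ₚ q = []
(x ∷ p) *ₚ q = map (x *_) q +ₚ (0ℝ ∷ p *ₚ q)

1ₚ : Poly
1ₚ = 1ℝ ∷ []

_^ₚ_ : Poly → ℕ → Poly
p ^ₚ zero  = 1ₚ
p ^ₚ suc n = p *ₚ p ^ₚ n

∏ₚ : ∀ {n} → (Fin n → Poly) → Poly
∏ₚ p = foldr _*ₚ_ 1ₚ (tabulate p)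

eval : Poly → ℝ → ℝ
eval []      z = 0ℝ
eval (x ∷ p) z = x + z * eval p z

------------------------------------------------------------------------
-- Formal power series

Series : Set
Series = ℕ → ℝ

infix  4 _≈ₛ_
infixl 7 _*ₛ_

_≈ₛ_ : Series → Series → Set
F ≈ₛ G = ∀ n → F n ≈ G n

_*ₛ_ : Series → Series → Series
(F *ₛ G) n = foldr _+_ 0ℝ (applyUpTo (λ i → F i * G (n ∸ i)) (suc n))

toSeries : Poly → Series
toSeries []      n       = 0ℝ
toSeries (x ∷ p) zero    = x
toSeries (x ∷ p) (suc n) = toSeries p n

valueSeries : Poly → Series
valueSeries f k = eval f (fromℕ k)

------------------------------------------------------------------------
-- h*-polynomials

-- Σₖ f(k) tᵏ = h(t) / (1 - t)ᵈ⁺¹, with the denominator cleared: (1 - t)ᵈ⁺¹ is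
-- invertible as a power series, so h is determined by f and d up to _≈_.
IsHStar : (d : ℕ) → Poly → (Fin (suc d) → ℝ) → Set
IsHStar d f h =
  valueSeries f *ₛ toSeries ((1ℝ ∷ - 1ℝ ∷ []) ^ₚ suc d) ≈ₛ toSeries (tabulate h)

-- Property (♢) for a polynomial f of degree d; `opposite i` is d - i.
record Diamond (d : ℕ) (f : Poly) : Set where
  field
    h*          : Fin (suc d) → ℝ
    isHStar     : IsHStar d f h*
    palindromic : ∀ i → h* i ≈ h* (opposite i)
    nonNegative : ∀ i → 0ℝ ≤ h* i

------------------------------------------------------------------------
-- CL-polynomials

record CLPolynomial (d : ℕ) : Set where
  field
    a   : ℝ
    a≉0 : ¬ (a ≈ 0ℝ)
    c   : Fin ⌊ d /2⌋ → ℝ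
    ¼≤c : ∀ i → ¼ ≤ c i

  b : Poly
  b with parity d
  ... | 0ℙ = a ∷ []
  ... | 1ℙ = (a ∷ []) *ₚ (1ℝ ∷ fromℕ 2 ∷ [])

  poly : Poly
  poly = b *ₚ ∏ₚ (λ i → c i ∷ 1ℝ ∷ 1ℝ ∷ [])

cBound : (d i : ℕ) → ℝ
cBound d i with parity d
... | 0ℙ = fromℕ (2 ℕ.* i ℕ.+ 1)
... | 1ℙ = fromℕ (2 ℕ.* i ℕ.+ 2)

{-# OPTIONS --safe #-}

-- Multiplying Σ f(k) tᵏ by (1 - t)ᵉ⁺¹ amounts to taking e + 1 backward
-- differences of the values of f.  If f has degree e and h*-vector h, then
-- (z² + z + c) f has h*-vector
--
--   h′ₙ = αₙ hₙ + βₙ₋₁ hₙ₋₁ + γₙ₋₂ hₙ₋₂,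
--
-- where, for j = e - i,
--
--   αᵢ = i (i + 1) + c,   βᵢ = 2 (i j + e + 1 - c),   γᵢ = j (j + 1) + c.
--
-- The reflection i ↔ j exchanges α with γ and fixes β, and all weights are
-- non-negative for 0 ≤ c ≤ e + 1.  So (♢) survives each factor in turn,
-- starting from b, whose h*-vector is (a) or (a, a).

module Submission where

open import Data.Fin.Base as Fin using (Fin; toℕ; opposite)
import Data.Fin.Properties as Fin
import Data.Integer.Base as ℤ
import Data.Integer.Properties as ℤ
open import Data.List.Base using ([]; _∷_; map; foldr; applyUpTo; tabulate)
open import Data.Nat.Base as ℕ using (ℕ; zero; suc; ⌊_/2⌋; parity)
import Data.Nat.Coprimality as ℕ
import Data.Nat.Properties as ℕ
open import Data.Parity.Base using (Parity; 0ℙ; 1ℙ)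
open import Data.Product.Base using (_×_; _,_; ∃-syntax)
open import Data.Rational.Base as ℚ using (ℚ; 0ℚ; 1ℚ; mkℚ)
import Data.Rational.Properties as ℚ
open import Data.Rational.Solver using (module +-*-Solver)
open import Data.Sum.Base using (_⊎_; inj₁; inj₂)
open import Function.Base using (_∘_)
open import Relation.Binary.PropositionalEquality using (_≡_; refl; sym; trans; cong; cong₂; subst; subst₂)
open import Relation.Nullary.Decidable.Core using (yes; no)
open import Defs

open +-*-Solver using (solve; con; _:+_; _:*_; _:-_; :-_; _:=_)
open CauchyProperties using (half-pos; half+half; eventually-bounded)

-- Equality term by term: the ring identities of ℚ hold for it, so that limits
-- are needed only for the order.

infix 4 _≋_ _≐_

_≋_ : ℝ → ℝ → Set
x ≋ y = ∀ m → seq x m ≡ seq y m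

_≐_ : Series → Series → Set
F ≐ G = ∀ n → F n ≋ G n

≋⇒≈ : ∀ {x y} → x ≋ y → x ≈ y
≋⇒≈ {x} {y} x≋y ε 0<ε = 0 , λ n _ →
  subst (λ r → ℚ.∣ r ∣ ℚ.< ε)
    (sym (trans (cong (ℚ._- seq y n) (x≋y n)) (ℚ.+-inverseʳ (seq y n)))) 0<ε

-- Natural numbers as rationals

ι : ℕ → ℚ
ι n = ℤ.+ n ℚ./ 1

-- The quotient defining `ι` is normalised by a gcd and does not reduce for a variable numerator.
-- Once it is written as an explicit `mkℚ` in lowest terms, rational addition computes.
ι-+ : ∀ m n → ι (m ℕ.+ n) ≡ ι m ℚ.+ ι n
ι-+ m n = sym (trans (cong₂ ℚ._+_ (ι-mkℚ m) (ι-mkℚ n))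
  (cong (ℚ._/ 1) (cong₂ ℤ._+_ (ℤ.*-identityʳ (ℤ.+ m)) (ℤ.*-identityʳ (ℤ.+ n)))))
  where
  coprime : ∀ n → ℕ.Coprime n 1
  coprime n = ℕ.sym (ℕ.1-coprimeTo n)
  ι-mkℚ : ∀ n → ι n ≡ mkℚ (ℤ.+ n) 0 (coprime n)
  ι-mkℚ n = ℚ.normalize-coprime (coprime n)

ι-suc : ∀ n → ι (suc n) ≡ 1ℚ ℚ.+ ι n
ι-suc n = ι-+ 1 n

ι-diff : ∀ {e} i j → i ℕ.+ j ≡ e → ι e ℚ.- ι i ≡ ι j
ι-diff i j refl rewrite ι-+ i j =
  solve 2 (λ i j → (i :+ j) :- i := j) refl (ι i) (ι j)

-- Non-negative reals

0≤-resp : ∀ {x y} → x ≋ y → 0ℝ ≤ x → 0ℝ ≤ y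
0≤-resp x≋y 0≤x ε 0<ε with 0≤x ε 0<ε
... | N , bound = N , λ n N≤n → subst (λ r → 0ℚ ℚ.< r ℚ.+ ε) (x≋y n) (bound n N≤n)

0≤fromℕ : ∀ n → 0ℝ ≤ fromℕ n
0≤fromℕ n ε 0<ε = 0 , λ _ _ →
  ℚ.+-mono-≤-< (ℚ.nonNegative⁻¹ (ι n) {{ℚ.normalize-nonNeg n 1}}) 0<ε

0≤-+ : ∀ {x y} → 0ℝ ≤ x → 0ℝ ≤ y → 0ℝ ≤ x + y
0≤-+ {x} {y} 0≤x 0≤y ε 0<ε with 0≤x (ℚ.½ ℚ.* ε) (half-pos 0<ε) | 0≤y (ℚ.½ ℚ.* ε) (half-pos 0<ε)
... | M , bx | N , by = M ℕ.⊔ N , λ n ≤n →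
  subst (0ℚ ℚ.<_) (regroup (seq x n) (seq y n))
    (ℚ.+-mono-< (bx n (ℕ.m⊔n≤o⇒m≤o M N ≤n)) (by n (ℕ.m⊔n≤o⇒n≤o M N ≤n)))
  where
  regroup : ∀ p q → (p ℚ.+ ℚ.½ ℚ.* ε) ℚ.+ (q ℚ.+ ℚ.½ ℚ.* ε) ≡ (p ℚ.+ q) ℚ.+ ε
  regroup p q = trans
    (solve 3 (λ p q h → (p :+ h) :+ (q :+ h) := (p :+ q) :+ (h :+ h)) refl p q (ℚ.½ ℚ.* ε))
    (cong ((p ℚ.+ q) ℚ.+_) (half+half ε))

x≤y⇒0≤y-x : ∀ {x y} → x ≤ y → 0ℝ ≤ y + - x
x≤y⇒0≤y-x {x} {y} x≤y ε 0<ε with x≤y ε 0<ε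
... | N , bound = N , λ n N≤n →
  subst₂ ℚ._<_ (ℚ.+-inverseʳ (seq x n))
    (solve 3 (λ x y ε → (y :+ ε) :- x := (y :- x) :+ ε) refl (seq x n) (seq y n) ε)
    (ℚ.+-monoˡ-< (ℚ.- seq x n) (bound n N≤n))

¼≤x⇒0≤x : ∀ {x} → ¼ ≤ x → 0ℝ ≤ x
¼≤x⇒0≤x ¼≤x ε 0<ε with ¼≤x ε 0<ε
... | N , bound = N , λ n N≤n → ℚ.<-trans (ℚ.positive⁻¹ (ℤ.+ 1 ℚ./ 4)) (bound n N≤n)

p≤∣p∣ : ∀ p → p ℚ.≤ ℚ.∣ p ∣
p≤∣p∣ p with ℚ.≤-total 0ℚ p
... | inj₁ 0≤p = ℚ.≤-reflexive (sym (ℚ.0≤p⇒∣p∣≡p 0≤p))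
... | inj₂ p≤0 = ℚ.≤-trans p≤0 (ℚ.0≤∣p∣ p)

-- Two factors that are non-negative up to `δ` have a product that is non-negative up to `D δ`. If
-- `u ≥ 0`, then `v > -δ` gives `u v ≥ -u δ > -D δ`; the case `v ≥ 0` is symmetric, and if both are
-- non-positive, the product is non-negative.
0<uv+Dδ : ∀ D δ u v → 0ℚ ℚ.< D → 0ℚ ℚ.< δ → u ℚ.< D → v ℚ.< D →
  0ℚ ℚ.< u ℚ.+ δ → 0ℚ ℚ.< v ℚ.+ δ → 0ℚ ℚ.< u ℚ.* v ℚ.+ D ℚ.* δ
0<uv+Dδ D δ u v 0<D 0<δ u<D v<D 0<u+δ 0<v+δ = cases (ℚ.≤-total 0ℚ u) (ℚ.≤-total 0ℚ v)
  where
  one-nonNeg : ∀ u v → 0ℚ ℚ.≤ u → u ℚ.< D → 0ℚ ℚ.< v ℚ.+ δ → 0ℚ ℚ.< u ℚ.* v ℚ.+ D ℚ.* δ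
  one-nonNeg u v 0≤u u<D 0<v+δ = begin-strict
    0ℚ                   ≡⟨ sym (ℚ.*-zeroʳ u) ⟩
    u ℚ.* 0ℚ             ≤⟨ ℚ.*-monoˡ-≤-nonNeg u {{ℚ.nonNegative 0≤u}} (ℚ.<⇒≤ 0<v+δ) ⟩
    u ℚ.* (v ℚ.+ δ)      ≡⟨ ℚ.*-distribˡ-+ u v δ ⟩
    u ℚ.* v ℚ.+ u ℚ.* δ  <⟨ ℚ.+-monoʳ-< (u ℚ.* v) (ℚ.*-monoˡ-<-pos δ {{ℚ.positive 0<δ}} u<D) ⟩
    u ℚ.* v ℚ.+ D ℚ.* δ  ∎
    where open ℚ.≤-Reasoning

  cases : 0ℚ ℚ.≤ u ⊎ u ℚ.≤ 0ℚ → 0ℚ ℚ.≤ v ⊎ v ℚ.≤ 0ℚ → 0ℚ ℚ.< u ℚ.* v ℚ.+ D ℚ.* δ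
  cases (inj₁ 0≤u) _          = one-nonNeg u v 0≤u u<D 0<v+δ
  cases (inj₂ _)   (inj₁ 0≤v) =
    subst (λ r → 0ℚ ℚ.< r ℚ.+ D ℚ.* δ) (ℚ.*-comm v u) (one-nonNeg v u 0≤v v<D 0<u+δ)
  cases (inj₂ u≤0) (inj₂ v≤0) = ℚ.+-mono-≤-<
    (subst (ℚ._≤ u ℚ.* v) (ℚ.*-zeroʳ u) (ℚ.*-monoˡ-≤-nonPos u {{ℚ.nonPositive u≤0}} v≤0))
    (subst (ℚ._< D ℚ.* δ) (ℚ.*-zeroʳ D) (ℚ.*-monoʳ-<-pos D {{ℚ.positive 0<D}} 0<δ))

divide : ∀ {D ε} → 0ℚ ℚ.< D → 0ℚ ℚ.< ε → ∃[ δ ] 0ℚ ℚ.< δ × D ℚ.* δ ≡ ε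
divide {D} {ε} 0<D 0<ε =
  ℚ.1/ D ℚ.* ε ,
  subst (ℚ._< ℚ.1/ D ℚ.* ε) (ℚ.*-zeroʳ (ℚ.1/ D)) (ℚ.*-monoʳ-<-pos (ℚ.1/ D) 0<ε) ,
  trans (sym (ℚ.*-assoc D (ℚ.1/ D) ε))
    (trans (cong (ℚ._* ε) (ℚ.*-inverseʳ D)) (ℚ.*-identityˡ ε))
  where
  instance
    D-pos = ℚ.positive 0<D
    D≢0 = ℚ.pos⇒nonZero D
    D⁻¹-pos = ℚ.1/pos⇒pos D

0≤-* : ∀ {x y} → 0ℝ ≤ x → 0ℝ ≤ y → 0ℝ ≤ x * y
0≤-* {x} {y} 0≤x 0≤y ε 0<ε =
  let B , 0<B , M , bx = eventually-bounded (cauchy x)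
      C , 0<C , N , by = eventually-bounded (cauchy y)
      -- The weak bounds `B` and `C` become strict and common to both sequences by passing to
      -- `D = B + C`; then `δ = ε / D`.
      0<D = ℚ.+-mono-< 0<B 0<C
      δ , 0<δ , Dδ≡ε = divide 0<D 0<ε
      P , lx = 0≤x δ 0<δ
      Q , ly = 0≤y δ 0<δ
  in (M ℕ.⊔ N) ℕ.⊔ (P ℕ.⊔ Q) , λ n ≤n →
    let MN≤n = ℕ.m⊔n≤o⇒m≤o (M ℕ.⊔ N) (P ℕ.⊔ Q) ≤n
        PQ≤n = ℕ.m⊔n≤o⇒n≤o (M ℕ.⊔ N) (P ℕ.⊔ Q) ≤n
    in subst (λ r → 0ℚ ℚ.< seq x n ℚ.* seq y n ℚ.+ r) Dδ≡ε
      (0<uv+Dδ (B ℚ.+ C) δ (seq x n) (seq y n) 0<D 0<δ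
        (ℚ.≤-<-trans (ℚ.≤-trans (p≤∣p∣ (seq x n)) (bx n (ℕ.m⊔n≤o⇒m≤o M N MN≤n))) (B<B+C B C 0<C))
        (ℚ.≤-<-trans (ℚ.≤-trans (p≤∣p∣ (seq y n)) (by n (ℕ.m⊔n≤o⇒n≤o M N MN≤n))) (C<B+C B C 0<B))
        (lx n (ℕ.m⊔n≤o⇒m≤o P Q PQ≤n)) (ly n (ℕ.m⊔n≤o⇒n≤o P Q PQ≤n)))
  where
  B<B+C : ∀ B C → 0ℚ ℚ.< C → B ℚ.< B ℚ.+ C
  B<B+C B C 0<C = subst (ℚ._< B ℚ.+ C) (ℚ.+-identityʳ B) (ℚ.+-monoʳ-< B 0<C)
  C<B+C : ∀ B C → 0ℚ ℚ.< B → C ℚ.< B ℚ.+ C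
  C<B+C B C 0<B = subst (ℚ._< B ℚ.+ C) (ℚ.+-identityˡ C) (ℚ.+-monoˡ-< C 0<B)

-- Polynomials and differences

eval-+ₚ : ∀ p q z → eval (p +ₚ q) z ≋ eval p z + eval q z
eval-+ₚ []      q       z m = sym (ℚ.+-identityˡ _)
eval-+ₚ (x ∷ p) []      z m = sym (ℚ.+-identityʳ _)
eval-+ₚ (x ∷ p) (y ∷ q) z m rewrite eval-+ₚ p q z m =
  solve 5 (λ x y z p q → (x :+ y) :+ z :* (p :+ q) := (x :+ z :* p) :+ (y :+ z :* q)) refl
    (seq x m) (seq y m) (seq z m) (seq (eval p z) m) (seq (eval q z) m)

eval-scale : ∀ x p z → eval (map (x *_) p) z ≋ x * eval p z
eval-scale x []      z m = sym (ℚ.*-zeroʳ (seq x m))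
eval-scale x (y ∷ p) z m rewrite eval-scale x p z m =
  solve 4 (λ x y z p → x :* y :+ z :* (x :* p) := x :* (y :+ z :* p)) refl
    (seq x m) (seq y m) (seq z m) (seq (eval p z) m)

eval-*ₚ : ∀ p q z → eval (p *ₚ q) z ≋ eval p z * eval q z
eval-*ₚ []      q z m = sym (ℚ.*-zeroˡ (seq (eval q z) m))
eval-*ₚ (x ∷ p) q z m
  rewrite eval-+ₚ (map (x *_) q) (0ℝ ∷ p *ₚ q) z m | eval-scale x q z m | eval-*ₚ p q z m =
  solve 4 (λ x z p q → x :* q :+ (con 0ℚ :+ z :* (p :* q)) := (x :+ z :* p) :* q) refl
    (seq x m) (seq z m) (seq (eval p z) m) (seq (eval q z) m)

-- S is multiplication by t and ∇ is multiplication by 1 - t.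
S : Series → Series
S F zero    = 0ℝ
S F (suc n) = F n

∇ : Series → Series
∇ F n = F n + - S F n

∇^ : ℕ → Series → Series
∇^ zero    F = F
∇^ (suc k) F = ∇ (∇^ k F)

S-cong : ∀ {F G} → F ≐ G → S F ≐ S G
S-cong F≐G zero    m = refl
S-cong F≐G (suc n) m = F≐G n m

∇-cong : ∀ {F G} → F ≐ G → ∇ F ≐ ∇ G
∇-cong {F} {G} F≐G n m = cong₂ ℚ._-_ (F≐G n m) (S-cong {F} {G} F≐G n m)

∇^-cong : ∀ k {F G} → F ≐ G → ∇^ k F ≐ ∇^ k G
∇^-cong zero    F≐G = F≐G
∇^-cong (suc k) {F} {G} F≐G = ∇-cong {∇^ k F} {∇^ k G} (∇^-cong k {F} {G} F≐G)

∇-+ : ∀ F G → ∇ (λ n → F n + G n) ≐ λ n → ∇ F n + ∇ G n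
∇-+ F G zero    m = solve 2 (λ f g → (f :+ g) :- con 0ℚ := (f :- con 0ℚ) :+ (g :- con 0ℚ)) refl
  (seq (F 0) m) (seq (G 0) m)
∇-+ F G (suc n) m = solve 4 (λ f g f′ g′ → (f :+ g) :- (f′ :+ g′) := (f :- f′) :+ (g :- g′)) refl
  (seq (F (suc n)) m) (seq (G (suc n)) m) (seq (F n) m) (seq (G n) m)

∇-* : ∀ x F → ∇ (λ n → x * F n) ≐ λ n → x * ∇ F n
∇-* x F zero    m = solve 2 (λ x f → x :* f :- con 0ℚ := x :* (f :- con 0ℚ)) refl (seq x m) (seq (F 0) m)
∇-* x F (suc n) m = solve 3 (λ x f f′ → x :* f :- x :* f′ := x :* (f :- f′)) refl
  (seq x m) (seq (F (suc n)) m) (seq (F n) m)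

∇^-+ : ∀ k F G → ∇^ k (λ n → F n + G n) ≐ λ n → ∇^ k F n + ∇^ k G n
∇^-+ zero    F G n m = refl
∇^-+ (suc k) F G n m = trans
  (∇-cong {∇^ k (λ n → F n + G n)} {λ n → ∇^ k F n + ∇^ k G n} (∇^-+ k F G) n m)
  (∇-+ (∇^ k F) (∇^ k G) n m)

∇^-* : ∀ k x F → ∇^ k (λ n → x * F n) ≐ λ n → x * ∇^ k F n
∇^-* zero    x F n m = refl
∇^-* (suc k) x F n m = trans
  (∇-cong {∇^ k (λ n → x * F n)} {λ n → x * ∇^ k F n} (∇^-* k x F) n m)
  (∇-* x (∇^ k F) n m)

-- The derivation t d/dt on generating functions; on values it is multiplication by z.
θ : Series → Series
θ F n = fromℕ n * F n

-- The Leibniz rule for t d/dt on the product of (1 - t)ᵏ⁺¹ with F, since t d/dt sends (1 - t)ᵏ⁺¹ to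
-- -(k + 1) t (1 - t)ᵏ.
∇^-θ : ∀ k F → ∇^ (suc k) (θ F) ≐ λ n → θ (∇^ (suc k) F) n + fromℕ (suc k) * S (∇^ k F) n
∇^-θ zero F zero m = solve 1 (λ f → con 0ℚ :* f :- con 0ℚ :=
    con 0ℚ :* (f :- con 0ℚ) :+ con 1ℚ :* con 0ℚ) refl (seq (F 0) m)
∇^-θ zero F (suc n) m = identity {ι n} {ι (suc n)} (ι-suc n) (seq (F (suc n)) m) (seq (F n) m)
  where
  -- `ι (suc n)` does not reduce to `1ℚ ℚ.+ ι n`, so the casts enter as variables with equations
  -- between them; matching these with `refl` leaves an identity for the ring solver.
  identity : ∀ {n n₁} → n₁ ≡ 1ℚ ℚ.+ n → ∀ f f′ →
    n₁ ℚ.* f ℚ.- n ℚ.* f′ ≡ n₁ ℚ.* (f ℚ.- f′) ℚ.+ 1ℚ ℚ.* f′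
  identity {n} refl = solve 3 (λ n f f′ → (con 1ℚ :+ n) :* f :- n :* f′ :=
    (con 1ℚ :+ n) :* (f :- f′) :+ con 1ℚ :* f′) refl n
∇^-θ (suc k) F n m = trans
  (∇-cong {∇^ (suc k) (θ F)} {λ n → θ (∇^ (suc k) F) n + fromℕ (suc k) * S (∇^ k F) n} (∇^-θ k F) n m)
  (shift n)
  where
  K = ∇^ k F
  identity : ∀ {n n₁ κ κ₁} → n₁ ≡ 1ℚ ℚ.+ n → κ₁ ≡ 1ℚ ℚ.+ κ → ∀ f f′ f″ →
    (n₁ ℚ.* (f ℚ.- f′) ℚ.+ κ ℚ.* f′) ℚ.- (n ℚ.* (f′ ℚ.- f″) ℚ.+ κ ℚ.* f″) ≡
    n₁ ℚ.* ((f ℚ.- f′) ℚ.- (f′ ℚ.- f″)) ℚ.+ κ₁ ℚ.* (f′ ℚ.- f″)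
  identity {n} {κ = κ} refl refl = solve 5 (λ n κ f f′ f″ →
      ((con 1ℚ :+ n) :* (f :- f′) :+ κ :* f′) :- (n :* (f′ :- f″) :+ κ :* f″) :=
      (con 1ℚ :+ n) :* ((f :- f′) :- (f′ :- f″)) :+ (con 1ℚ :+ κ) :* (f′ :- f″)) refl n κ
  shift : ∀ n → seq (∇ (λ n → θ (∇^ (suc k) F) n + fromℕ (suc k) * S (∇^ k F) n) n) m ≡
                seq (θ (∇^ (suc (suc k)) F) n + fromℕ (suc (suc k)) * S (∇^ (suc k) F) n) m
  shift zero = solve 3 (λ f κ κ′ →
      (con 0ℚ :* (f :- con 0ℚ) :+ κ :* con 0ℚ) :- con 0ℚ :=
      con 0ℚ :* ((f :- con 0ℚ) :- con 0ℚ) :+ κ′ :* con 0ℚ) refl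
    (seq (K 0) m) (ι (suc k)) (ι (suc (suc k)))
  -- Leaving `S K n` unevaluated lets one identity serve both `n = 0`, where it is zero, and
  -- `n > 0`.
  shift (suc n) = identity {ι n} {ι (suc n)} {ι (suc k)} {ι (suc (suc k))}
    (ι-suc n) (ι-suc (suc k)) (seq (K (suc n)) m) (seq (K n) m) (seq (S K n) m)

-- Multiplication by a power of 1 - t

-- Comparing F *ₛ G with its tail by conversion would unfold Cauchy proofs,
-- hence the detour through rational sums.

Σℚ : (ℕ → ℚ) → ℕ → ℚ
Σℚ f zero    = 0ℚ
Σℚ f (suc n) = f 0 ℚ.+ Σℚ (f ∘ suc) n

seq-sum : ∀ (f : Series) n m → seq (foldr _+_ 0ℝ (applyUpTo f n)) m ≡ Σℚ (λ i → seq (f i) m) n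
seq-sum f zero    m = refl
seq-sum f (suc n) m = cong (seq (f 0) m ℚ.+_) (seq-sum (f ∘ suc) n m)

-- The Cauchy product, peeling coefficients off the first factor while the second stays fixed. The
-- trailing `0ℝ` is the empty sum that ends the fold in `_*ₛ_`.
conv : Series → Series → Series
conv F G zero    = F 0 * G 0 + 0ℝ
conv F G (suc n) = F 0 * G (suc n) + conv (F ∘ suc) G n

Σℚ-conv : ∀ F G n m → Σℚ (λ i → seq (F i) m ℚ.* seq (G (n ℕ.∸ i)) m) (suc n) ≡ seq (conv F G n) m
Σℚ-conv F G zero    m = refl
Σℚ-conv F G (suc n) m = cong (seq (F 0) m ℚ.* seq (G (suc n)) m ℚ.+_) (Σℚ-conv (F ∘ suc) G n m)

*ₛ-conv : ∀ F G → F *ₛ G ≐ conv F G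
*ₛ-conv F G n m = trans (seq-sum (λ i → F i * G (n ℕ.∸ i)) (suc n) m) (Σℚ-conv F G n m)

conv-cong : ∀ F {G G′} → G ≐ G′ → conv F G ≐ conv F G′
conv-cong F G≐G′ zero    m = cong (λ g → seq (F 0) m ℚ.* g ℚ.+ 0ℚ) (G≐G′ 0 m)
conv-cong F {G} {G′} G≐G′ (suc n) m = cong₂ (λ g r → seq (F 0) m ℚ.* g ℚ.+ r)
  (G≐G′ (suc n) m) (conv-cong (F ∘ suc) {G} {G′} G≐G′ n m)

conv-1ₚ : ∀ F → conv F (toSeries 1ₚ) ≐ F
conv-1ₚ F zero    m = solve 1 (λ f → f :* con 1ℚ :+ con 0ℚ := f) refl (seq (F 0) m)
conv-1ₚ F (suc n) m = trans (cong (seq (F 0) m ℚ.* 0ℚ ℚ.+_) (conv-1ₚ (F ∘ suc) n m))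
  (solve 2 (λ f g → f :* con 0ℚ :+ g := g) refl (seq (F 0) m) (seq (F (suc n)) m))

-- The factor 1 - t may be pulled out of the second series. Iterated, this turns multiplication by a
-- power of 1 - t into repeated differences.
conv-∇ : ∀ F G → conv F (∇ G) ≐ ∇ (conv F G)
conv-∇ F G zero m = solve 2 (λ f g → f :* (g :- con 0ℚ) :+ con 0ℚ := (f :* g :+ con 0ℚ) :- con 0ℚ) refl
  (seq (F 0) m) (seq (G 0) m)
conv-∇ F G (suc n) m = trans
  (cong (seq (F 0) m ℚ.* seq (∇ G (suc n)) m ℚ.+_) (conv-∇ (F ∘ suc) G n m)) (shift n)
  where
  shift : ∀ n → seq (F 0 * ∇ G (suc n) + ∇ (conv (F ∘ suc) G) n) m ≡ seq (∇ (conv F G) (suc n)) m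
  shift zero = solve 4 (λ f g g′ r → f :* (g :- g′) :+ (r :- con 0ℚ) := (f :* g :+ r) :- (f :* g′ :+ con 0ℚ)) refl
    (seq (F 0) m) (seq (G 1) m) (seq (G 0) m) (seq (conv (F ∘ suc) G 0) m)
  shift (suc n) = solve 5 (λ f g g′ r r′ → f :* (g :- g′) :+ (r :- r′) := (f :* g :+ r) :- (f :* g′ :+ r′)) refl
    (seq (F 0) m) (seq (G (suc (suc n))) m) (seq (G (suc n)) m)
    (seq (conv (F ∘ suc) G (suc n)) m) (seq (conv (F ∘ suc) G n) m)

toSeries-+ₚ : ∀ p q → toSeries (p +ₚ q) ≐ λ n → toSeries p n + toSeries q n
toSeries-+ₚ []      q       n       m = sym (ℚ.+-identityˡ _)
toSeries-+ₚ (x ∷ p) []      n       m = sym (ℚ.+-identityʳ _)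
toSeries-+ₚ (x ∷ p) (y ∷ q) zero    m = refl
toSeries-+ₚ (x ∷ p) (y ∷ q) (suc n) m = toSeries-+ₚ p q n m

toSeries-scale : ∀ x p → toSeries (map (x *_) p) ≐ λ n → x * toSeries p n
toSeries-scale x []      n       m = sym (ℚ.*-zeroʳ (seq x m))
toSeries-scale x (y ∷ p) zero    m = refl
toSeries-scale x (y ∷ p) (suc n) m = toSeries-scale x p n m

toSeries-0 : toSeries (0ℝ ∷ []) ≐ λ _ → 0ℝ
toSeries-0 zero    m = refl
toSeries-0 (suc n) m = refl

toSeries-1-t : ∀ p → toSeries ((1ℝ ∷ - 1ℝ ∷ []) *ₚ p) ≐ ∇ (toSeries p)
toSeries-1-t p n m = trans
  (trans (toSeries-+ₚ (map (1ℝ *_) p) (0ℝ ∷ p′) n m)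
         (cong (ℚ._+ seq (toSeries (0ℝ ∷ p′) n) m) (toSeries-scale 1ℝ p n m)))
  (shift n)
  where
  -- The result of unfolding `(- 1ℝ ∷ []) *ₚ p`; the padding `0ℝ ∷ []` is handled by `toSeries-0`.
  p′ = map (- 1ℝ *_) p +ₚ (0ℝ ∷ [])
  shift : ∀ n → seq (1ℝ * toSeries p n + toSeries (0ℝ ∷ p′) n) m ≡ seq (∇ (toSeries p) n) m
  shift zero = solve 1 (λ x → con 1ℚ :* x :+ con 0ℚ := x :- con 0ℚ) refl (seq (toSeries p 0) m)
  shift (suc n) = trans
    (cong (1ℚ ℚ.* seq (toSeries p (suc n)) m ℚ.+_)
      (trans (toSeries-+ₚ (map (- 1ℝ *_) p) (0ℝ ∷ []) n m)
             (cong₂ ℚ._+_ (toSeries-scale (- 1ℝ) p n m) (toSeries-0 n m))))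
    (solve 2 (λ x y → con 1ℚ :* x :+ ((:- con 1ℚ) :* y :+ con 0ℚ) := x :- y) refl
      (seq (toSeries p (suc n)) m) (seq (toSeries p n) m))

-- With `k = suc d` this makes `IsHStar` explicit: the coefficients of h* are the `suc d`-fold
-- differences of the values.
conv-[1-t]^ : ∀ k F → conv F (toSeries ((1ℝ ∷ - 1ℝ ∷ []) ^ₚ k)) ≐ ∇^ k F
conv-[1-t]^ zero    F n m = conv-1ₚ F n m
conv-[1-t]^ (suc k) F n m = trans
  (conv-cong F {toSeries ((1ℝ ∷ - 1ℝ ∷ []) ^ₚ suc k)} {∇ (toSeries p)} (toSeries-1-t p) n m)
  (trans (conv-∇ F (toSeries p) n m)
         (∇-cong {conv F (toSeries p)} {∇^ k F} (conv-[1-t]^ k F) n m))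
  where p = (1ℝ ∷ - 1ℝ ∷ []) ^ₚ k

-- Multiplication by z² + z + c

outer : ℝ → ℝ → ℝ
outer c x = x * (x + 1ℝ) + c

-- The difference e - i is taken in the reals, not truncated, so that the weights remain polynomial
-- in i even for i > e.
α β γ : ℕ → ℝ → ℕ → ℝ
α e c i = outer c (fromℕ i)
β e c i = fromℕ 2 * (fromℕ i * (fromℕ e + - fromℕ i) + (fromℕ (suc e) + - c))
γ e c i = outer c (fromℕ e + - fromℕ i)

spread : (A B C : Series) → Series
spread A B C n = A n + (S B n + S (S C) n)

step : ℕ → ℝ → Series → Series
step e c H = spread (λ i → α e c i * H i) (λ i → β e c i * H i) (λ i → γ e c i * H i)

-- The h*-vector of z F(z), for F of degree e.
zTimes : ℕ → Series → Series
zTimes e F n = θ (∇^ (suc (suc e)) F) n + fromℕ (suc (suc e)) * S (∇^ (suc e) F) n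

-- The left side is what the Leibniz rule yields for z (z F) + z F + c F. Both sides are linear in
-- at most three neighbouring entries of `∇^ (suc e) F`, and their coefficients agree as polynomials
-- in e, n and c. Indices 0 and 1 are separate because shifted terms are missing there.
step-identity : ∀ e c F →
  (λ n → (θ (∇ (zTimes e F)) n + fromℕ (suc (suc (suc e))) * S (zTimes e F) n) +
         (∇ (zTimes e F) n + c * ∇^ (suc (suc (suc e))) F n))
  ≐ step e c (∇^ (suc e) F)
step-identity e c F zero m = solve 4 (λ c h e₂ e₃ →
    let z = con 0ℚ
        t = z :* (h :- z) :+ e₂ :* z
    in (z :* (t :- z) :+ e₃ :* z) :+ ((t :- z) :+ c :* ((h :- z) :- z)) :=
       (z :* (z :+ con 1ℚ) :+ c) :* h :+ (z :+ z))
  refl (seq c m) (seq (∇^ (suc e) F 0) m) (ι (suc (suc e))) (ι (suc (suc (suc e))))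
step-identity e c F (suc zero) m =
  identity {ι e} {ι (suc e)} {ι (suc (suc e))} {ι (suc (suc (suc e)))}
    (ι-suc e) (ι-suc (suc e)) (ι-suc (suc (suc e))) (seq c m) (seq (∇^ (suc e) F 1) m) (seq (∇^ (suc e) F 0) m)
  where
  identity : ∀ {e e₁ e₂ e₃} → e₁ ≡ 1ℚ ℚ.+ e → e₂ ≡ 1ℚ ℚ.+ e₁ → e₃ ≡ 1ℚ ℚ.+ e₂ → ∀ c h₁ h₀ →
    let t₁ = 1ℚ ℚ.* (h₁ ℚ.- h₀) ℚ.+ e₂ ℚ.* h₀
        t₀ = 0ℚ ℚ.* (h₀ ℚ.- 0ℚ) ℚ.+ e₂ ℚ.* 0ℚ
    in (1ℚ ℚ.* (t₁ ℚ.- t₀) ℚ.+ e₃ ℚ.* t₀) ℚ.+ ((t₁ ℚ.- t₀) ℚ.+ c ℚ.* ((h₁ ℚ.- h₀) ℚ.- (h₀ ℚ.- 0ℚ))) ≡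
       (1ℚ ℚ.* (1ℚ ℚ.+ 1ℚ) ℚ.+ c) ℚ.* h₁
         ℚ.+ ((ι 2 ℚ.* (0ℚ ℚ.* (e ℚ.- 0ℚ) ℚ.+ (e₁ ℚ.- c))) ℚ.* h₀ ℚ.+ 0ℚ)
  identity {e} refl refl refl = solve 4 (λ e c h₁ h₀ →
    let z = con 0ℚ
        o = con 1ℚ
        e₁ = o :+ e
        e₂ = o :+ e₁
        e₃ = o :+ e₂
        t₁ = o :* (h₁ :- h₀) :+ e₂ :* h₀
        t₀ = z :* (h₀ :- z) :+ e₂ :* z
    in (o :* (t₁ :- t₀) :+ e₃ :* t₀) :+ ((t₁ :- t₀) :+ c :* ((h₁ :- h₀) :- (h₀ :- z))) :=
       (o :* (o :+ o) :+ c) :* h₁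
         :+ ((con (ι 2) :* (z :* (e :- z) :+ (e₁ :- c))) :* h₀ :+ z)) refl e
step-identity e c F (suc (suc n)) m =
  identity {ι e} {ι (suc e)} {ι (suc (suc e))} {ι (suc (suc (suc e)))}
    {ι n} {ι (suc n)} {ι (suc (suc n))}
    (ι-suc e) (ι-suc (suc e)) (ι-suc (suc (suc e))) (ι-suc n) (ι-suc (suc n))
    (seq c m) (seq (∇^ (suc e) F (suc (suc n))) m) (seq (∇^ (suc e) F (suc n)) m) (seq (∇^ (suc e) F n) m)
  where
  identity : ∀ {e e₁ e₂ e₃ n n₁ n₂} → e₁ ≡ 1ℚ ℚ.+ e → e₂ ≡ 1ℚ ℚ.+ e₁ → e₃ ≡ 1ℚ ℚ.+ e₂ →
    n₁ ≡ 1ℚ ℚ.+ n → n₂ ≡ 1ℚ ℚ.+ n₁ → ∀ c h₂ h₁ h₀ →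
    let t₂ = n₂ ℚ.* (h₂ ℚ.- h₁) ℚ.+ e₂ ℚ.* h₁
        t₁ = n₁ ℚ.* (h₁ ℚ.- h₀) ℚ.+ e₂ ℚ.* h₀
    in (n₂ ℚ.* (t₂ ℚ.- t₁) ℚ.+ e₃ ℚ.* t₁) ℚ.+ ((t₂ ℚ.- t₁) ℚ.+ c ℚ.* ((h₂ ℚ.- h₁) ℚ.- (h₁ ℚ.- h₀))) ≡
       (n₂ ℚ.* (n₂ ℚ.+ 1ℚ) ℚ.+ c) ℚ.* h₂
         ℚ.+ ((ι 2 ℚ.* (n₁ ℚ.* (e ℚ.- n₁) ℚ.+ (e₁ ℚ.- c))) ℚ.* h₁
         ℚ.+ ((e ℚ.- n) ℚ.* ((e ℚ.- n) ℚ.+ 1ℚ) ℚ.+ c) ℚ.* h₀)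
  identity {e} {n = n} refl refl refl refl refl = solve 6 (λ e n c h₂ h₁ h₀ →
    let o = con 1ℚ
        e₁ = o :+ e
        e₂ = o :+ e₁
        e₃ = o :+ e₂
        n₁ = o :+ n
        n₂ = o :+ n₁
        t₂ = n₂ :* (h₂ :- h₁) :+ e₂ :* h₁
        t₁ = n₁ :* (h₁ :- h₀) :+ e₂ :* h₀
    in (n₂ :* (t₂ :- t₁) :+ e₃ :* t₁) :+ ((t₂ :- t₁) :+ c :* ((h₂ :- h₁) :- (h₁ :- h₀))) :=
       (n₂ :* (n₂ :+ o) :+ c) :* h₂
         :+ ((con (ι 2) :* (n₁ :* (e :- n₁) :+ (e₁ :- c))) :* h₁
         :+ ((e :- n) :* ((e :- n) :+ o) :+ c) :* h₀)) refl e n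

infixl 7 _·_

-- `F` is any sequence of values, so the induction over the factors need not carry it as a
-- polynomial.
_·_ : Series → Poly → Series
(F · p) k = F k * eval p (fromℕ k)

∇^-quadratic : ∀ e c F → ∇^ (suc (suc (suc e))) (F · (c ∷ 1ℝ ∷ 1ℝ ∷ [])) ≐ step e c (∇^ (suc e) F)
∇^-quadratic e c F n m =
  trans (∇^-cong k {F · (c ∷ 1ℝ ∷ 1ℝ ∷ [])}
          {λ i → θ (θ F) i + (θ F i + c * F i)} expand n m)
  (trans (∇^-+ k (θ (θ F)) (λ i → θ F i + c * F i) n m)
  (trans (cong₂ ℚ._+_
           -- The outer Leibniz rule leaves `∇^ k (θ F)` and `∇^ (suc (suc e)) (θ F)`; the inner one
           -- expresses both through `zTimes e F`.
           (trans (∇^-θ (suc (suc e)) (θ F) n m)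
             (cong₂ ℚ._+_ (cong (ι n ℚ.*_) (∇zTimes n m))
                          (cong (ι k ℚ.*_) (S-cong {∇^ (suc (suc e)) (θ F)} {zTimes e F} (∇^-θ (suc e) F) n m))))
           (trans (∇^-+ k (θ F) (λ i → c * F i) n m)
                  (cong₂ ℚ._+_ (∇zTimes n m) (∇^-* k c F n m))))
         (step-identity e c F n m)))
  where
  k = suc (suc (suc e))
  ∇zTimes : ∇^ k (θ F) ≐ ∇ (zTimes e F)
  ∇zTimes = ∇-cong {∇^ (suc (suc e)) (θ F)} {zTimes e F} (∇^-θ (suc e) F)
  expand : F · (c ∷ 1ℝ ∷ 1ℝ ∷ []) ≐ λ i → θ (θ F) i + (θ F i + c * F i)
  expand i m = solve 3 (λ i c f →
      f :* (c :+ i :* (con 1ℚ :+ i :* (con 1ℚ :+ i :* con 0ℚ))) :=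
      i :* (i :* f) :+ (i :* f :+ c :* f)) refl
    (ι i) (seq c m) (seq (F i) m)

-- Palindromic non-negative sequences

-- The vector is kept as an infinite series: `vanishing` replaces the index bound of `Fin`, and
-- `i ℕ.+ j ≡ e` replaces `opposite`.
record IsDiamond (e : ℕ) (H : Series) : Set where
  field
    vanishing   : ∀ i → e ℕ.< i → H i ≋ 0ℝ
    palindromic : ∀ i j → i ℕ.+ j ≡ e → H i ≋ H j
    nonNegative : ∀ i → 0ℝ ≤ H i

IsDiamond-resp-≐ : ∀ {e H H′} → H ≐ H′ → IsDiamond e H → IsDiamond e H′
IsDiamond-resp-≐ {H = H} {H′} eq D = record
  { vanishing   = λ i e<i m → trans (sym (eq i m)) (vanishing i e<i m)
  ; palindromic = λ i j i+j≡e m → trans (sym (eq i m)) (trans (palindromic i j i+j≡e m) (eq j m))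
  ; nonNegative = λ i → 0≤-resp {H i} {H′ i} (eq i) (nonNegative i)
  }
  where open IsDiamond D

+-suc-suc : ∀ m n → m ℕ.+ suc (suc n) ≡ suc (suc (m ℕ.+ n))
+-suc-suc m n = trans (ℕ.+-suc m (suc n)) (cong suc (ℕ.+-suc m n))

-- In generating functions `spread` is A + t B + t² C, and reversal in degree e + 2 exchanges A with
-- t² C and fixes t B. The shifted terms missing at indices 0 and 1 are mirrored by entries of `A`
-- and `B` beyond `e`, which vanish.
spread-isDiamond : ∀ e A B C →
  (∀ i → e ℕ.< i → A i ≋ 0ℝ) → (∀ i → e ℕ.< i → B i ≋ 0ℝ) → (∀ i → e ℕ.< i → C i ≋ 0ℝ) →
  (∀ i j → i ℕ.+ j ≡ e → A i ≋ C j) → (∀ i j → i ℕ.+ j ≡ e → B i ≋ B j) →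
  (∀ i → 0ℝ ≤ A i) → (∀ i → 0ℝ ≤ B i) → (∀ i → 0ℝ ≤ C i) →
  IsDiamond (suc (suc e)) (spread A B C)
spread-isDiamond e A B C A≋0 B≋0 C≋0 A≋C B≋B 0≤A 0≤B 0≤C = record
  { vanishing = vanish ; palindromic = pal ; nonNegative = nonNeg }
  where
  D = spread A B C

  vanish : ∀ i → suc (suc e) ℕ.< i → D i ≋ 0ℝ
  vanish (suc zero)    (ℕ.s≤s ())
  vanish (suc (suc i)) (ℕ.s≤s (ℕ.s≤s e<i)) m = cong₂ ℚ._+_
    (A≋0 (suc (suc i)) (ℕ.m<n⇒m<1+n (ℕ.m<n⇒m<1+n e<i)) m)
    (cong₂ ℚ._+_ (B≋0 (suc i) (ℕ.m<n⇒m<1+n e<i) m) (C≋0 i e<i m))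

  nonNeg : ∀ i → 0ℝ ≤ D i
  nonNeg zero          = 0≤-+ {A 0} {0ℝ + 0ℝ} (0≤A 0) (0≤-+ {0ℝ} {0ℝ} (0≤fromℕ 0) (0≤fromℕ 0))
  nonNeg (suc zero)    = 0≤-+ {A 1} {B 0 + 0ℝ} (0≤A 1) (0≤-+ {B 0} {0ℝ} (0≤B 0) (0≤fromℕ 0))
  nonNeg (suc (suc i)) = 0≤-+ {A (suc (suc i))} {B (suc i) + C i} (0≤A (suc (suc i)))
    (0≤-+ {B (suc i)} {C i} (0≤B (suc i)) (0≤C i))

  rotate : ∀ a b c → c ℚ.+ (b ℚ.+ a) ≡ a ℚ.+ (b ℚ.+ c)
  rotate = solve 3 (λ a b c → c :+ (b :+ a) := a :+ (b :+ c)) refl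

  pal₀ : D 0 ≋ D (suc (suc e))
  pal₀ m = trans (rotate 0ℚ 0ℚ (seq (A 0) m))
    (cong₂ ℚ._+_ (sym (A≋0 (suc (suc e)) (ℕ.m<n⇒m<1+n (ℕ.n<1+n e)) m))
      (cong₂ ℚ._+_ (sym (B≋0 (suc e) (ℕ.n<1+n e) m)) (A≋C 0 e refl m)))

  pal₁ : ∀ k → suc k ≡ e → D 1 ≋ D (suc (suc k))
  pal₁ k 1+k≡e m = trans (rotate 0ℚ (seq (B 0) m) (seq (A 1) m))
    (cong₂ ℚ._+_ (sym (A≋0 (suc (suc k)) (ℕ.≤-reflexive (cong suc (sym 1+k≡e))) m))
      (cong₂ ℚ._+_ (B≋B 0 (suc k) 1+k≡e m) (A≋C 1 k 1+k≡e m)))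

  pal : ∀ i j → i ℕ.+ j ≡ suc (suc e) → D i ≋ D j
  pal zero          j             refl m = pal₀ m
  -- Here `e = 0`, and the middle entry is its own mirror image.
  pal (suc zero)    (suc zero)    eq   m = refl
  pal (suc zero)    (suc (suc j)) eq   m = pal₁ j (ℕ.suc-injective (ℕ.suc-injective eq)) m
  pal (suc (suc i)) zero          eq   m =
    subst (λ k → seq (D k) m ≡ seq (D 0) m) (trans (sym eq) (ℕ.+-identityʳ (suc (suc i)))) (sym (pal₀ m))
  pal (suc (suc i)) (suc zero)    eq   m =
    sym (pal₁ i (trans (ℕ.+-comm 1 i) (ℕ.suc-injective (ℕ.suc-injective eq))) m)
  pal (suc (suc i)) (suc (suc j)) eq   m = trans
    (cong₂ ℚ._+_ (A≋C (suc (suc i)) j (trans (sym (+-suc-suc i j)) eq′) m)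
      (cong₂ ℚ._+_ (B≋B (suc i) (suc j) (trans (sym (ℕ.+-suc i (suc j))) eq′) m)
                   (sym (A≋C (suc (suc j)) i (trans (ℕ.+-comm (suc (suc j)) i) eq′) m))))
    (rotate (seq (A (suc (suc j))) m) (seq (B (suc j)) m) (seq (C j) m))
    where
    eq′ : i ℕ.+ suc (suc j) ≡ e
    eq′ = ℕ.suc-injective (ℕ.suc-injective eq)

weighted-vanishing : ∀ {e} {H : Series} (w : ℕ → ℝ) → (∀ i → e ℕ.< i → H i ≋ 0ℝ) → ∀ i → e ℕ.< i → w i * H i ≋ 0ℝ
weighted-vanishing w H≋0 i e<i m =
  trans (cong (seq (w i) m ℚ.*_) (H≋0 i e<i m)) (ℚ.*-zeroʳ (seq (w i) m))

-- Beyond `e` the series vanishes, so the sign of the weight matters only up to `e`. This is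
-- essential for `β`, which can be negative further on.
weighted-nonNegative : ∀ {e H} (w : ℕ → ℝ) → IsDiamond e H →
  (∀ i j → i ℕ.+ j ≡ e → 0ℝ ≤ w i) → ∀ i → 0ℝ ≤ w i * H i
weighted-nonNegative {e} {H} w D 0≤w i with i ℕ.≤? e
... | yes i≤e = 0≤-* {w i} {H i} (0≤w i (e ℕ.∸ i) (ℕ.m+[n∸m]≡n i≤e)) (IsDiamond.nonNegative D i)
... | no  i≰e = 0≤-resp {0ℝ} {w i * H i}
  (λ m → sym (weighted-vanishing {e} {H} w (IsDiamond.vanishing D) i (ℕ.≰⇒> i≰e) m)) (0≤fromℕ 0)

step-isDiamond : ∀ e c H → 0ℝ ≤ c → c ≤ fromℕ (suc e) → IsDiamond e H →
  IsDiamond (suc (suc e)) (step e c H)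
step-isDiamond e c H 0≤c c≤1+e D = spread-isDiamond e
  (λ i → α e c i * H i) (λ i → β e c i * H i) (λ i → γ e c i * H i)
  (weighted-vanishing {e} {H} (α e c) vanishing)
  (weighted-vanishing {e} {H} (β e c) vanishing)
  (weighted-vanishing {e} {H} (γ e c) vanishing)
  (λ i j i+j≡e m → cong₂ ℚ._*_ (α≋γ i j i+j≡e m) (palindromic i j i+j≡e m))
  (λ i j i+j≡e m → cong₂ ℚ._*_ (β≋β i j i+j≡e m) (palindromic i j i+j≡e m))
  (weighted-nonNegative {e} {H} (α e c) D λ i _ _ → 0≤outer (fromℕ i) (0≤fromℕ i))
  (weighted-nonNegative {e} {H} (β e c) D 0≤β)
  (weighted-nonNegative {e} {H} (γ e c) D λ i j i+j≡e → 0≤outer (fromℕ e + - fromℕ i) (0≤diff i j i+j≡e))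
  where
  open IsDiamond D

  swap : ∀ i j → i ℕ.+ j ≡ e → j ℕ.+ i ≡ e
  swap i j i+j≡e = trans (ℕ.+-comm j i) i+j≡e

  α≋γ : ∀ i j → i ℕ.+ j ≡ e → α e c i ≋ γ e c j
  α≋γ i j i+j≡e m = cong (λ x → x ℚ.* (x ℚ.+ 1ℚ) ℚ.+ seq c m) (sym (ι-diff j i (swap i j i+j≡e)))

  β≋β : ∀ i j → i ℕ.+ j ≡ e → β e c i ≋ β e c j
  β≋β i j i+j≡e m = cong (λ x → ι 2 ℚ.* (x ℚ.+ (ι (suc e) ℚ.- seq c m)))
    (trans (cong (ι i ℚ.*_) (ι-diff i j i+j≡e))
    (trans (ℚ.*-comm (ι i) (ι j)) (cong (ι j ℚ.*_) (sym (ι-diff j i (swap i j i+j≡e))))))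

  0≤diff : ∀ i j → i ℕ.+ j ≡ e → 0ℝ ≤ fromℕ e + - fromℕ i
  0≤diff i j i+j≡e = 0≤-resp {fromℕ j} {fromℕ e + - fromℕ i} (λ m → sym (ι-diff i j i+j≡e)) (0≤fromℕ j)

  0≤outer : ∀ x → 0ℝ ≤ x → 0ℝ ≤ outer c x
  0≤outer x 0≤x = 0≤-+ {x * (x + 1ℝ)} {c}
    (0≤-* {x} {x + 1ℝ} 0≤x (0≤-+ {x} {1ℝ} 0≤x (0≤fromℕ 1))) 0≤c

  0≤β : ∀ i j → i ℕ.+ j ≡ e → 0ℝ ≤ β e c i
  -- The term i (e - i) is zero at both ends, where `β` equals 2 (e + 1 - c); this is where the
  -- upper bound on `c` enters.
  0≤β i j i+j≡e = 0≤-* {fromℕ 2} {fromℕ i * (fromℕ e + - fromℕ i) + (fromℕ (suc e) + - c)} (0≤fromℕ 2)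
    (0≤-+ {fromℕ i * (fromℕ e + - fromℕ i)} {fromℕ (suc e) + - c}
      (0≤-* {fromℕ i} {fromℕ e + - fromℕ i} (0≤fromℕ i) (0≤diff i j i+j≡e))
      (x≤y⇒0≤y-x {c} {fromℕ (suc e)} c≤1+e))

-- Products of quadratic factors

quadratic : ∀ {n} → (Fin n → ℝ) → Fin n → Poly
quadratic c i = c i ∷ 1ℝ ∷ 1ℝ ∷ []

∏ₚ-quadratic : ∀ {n} (c : Fin (suc n) → ℝ) →
  ∏ₚ (quadratic c) ≡ (c Fin.zero ∷ 1ℝ ∷ 1ℝ ∷ []) *ₚ ∏ₚ (quadratic (c ∘ Fin.suc))
∏ₚ-quadratic c = refl

-- A record rather than a synonym, so that only F is compared by conversion.
record HasDiamond (e : ℕ) (F : Series) : Set where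
  constructor hasDiamond
  field
    isDiamond : IsDiamond e (∇^ (suc e) F)

HasDiamond-resp-≐ : ∀ {e} F G → F ≐ G → HasDiamond e F → HasDiamond e G
HasDiamond-resp-≐ {e} F G F≐G (hasDiamond D) =
  hasDiamond (IsDiamond-resp-≐ {e} {∇^ (suc e) F} {∇^ (suc e) G} (∇^-cong (suc e) {F} {G} F≐G) D)

quadratic-hasDiamond : ∀ e c F → 0ℝ ≤ c → c ≤ fromℕ (suc e) → HasDiamond e F →
  HasDiamond (suc (suc e)) (F · (c ∷ 1ℝ ∷ 1ℝ ∷ []))
quadratic-hasDiamond e c F 0≤c c≤1+e (hasDiamond D) = hasDiamond
  (IsDiamond-resp-≐ {suc (suc e)} {step e c (∇^ (suc e) F)}
    {∇^ (suc (suc (suc e))) (F · (c ∷ 1ℝ ∷ 1ℝ ∷ []))}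
    (λ n m → sym (∇^-quadratic e c F n m))
    (step-isDiamond e c (∇^ (suc e) F) 0≤c c≤1+e D))

-- Each factor raises the degree by two, so the factor with index i meets degree 2i + e and may have
-- a constant up to 2i + e + 1. Absorbing the first factor replaces `e` by e + 2 and lowers the
-- remaining indices by one, which leaves these bounds unchanged.
product-hasDiamond : ∀ n e F (c : Fin n → ℝ) → HasDiamond e F →
  (∀ i → 0ℝ ≤ c i) → (∀ i → c i ≤ fromℕ (2 ℕ.* toℕ i ℕ.+ suc e)) →
  HasDiamond (n ℕ.* 2 ℕ.+ e) (F · ∏ₚ (quadratic c))
product-hasDiamond zero e F c D 0≤c c≤ = HasDiamond-resp-≐ F (F · ∏ₚ (quadratic c))
  (λ k m → solve 2 (λ f k → f := f :* (con 1ℚ :+ k :* con 0ℚ)) refl (seq (F k) m) (ι k)) D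
product-hasDiamond (suc n) e F c D 0≤c c≤ =
  subst (λ N → HasDiamond N (F · ∏ₚ (quadratic c))) (+-suc-suc (n ℕ.* 2) e)
    (HasDiamond-resp-≐ ((F · (c Fin.zero ∷ 1ℝ ∷ 1ℝ ∷ [])) · ∏ₚ (quadratic (c ∘ Fin.suc)))
      (F · ∏ₚ (quadratic c)) reassociate
      (product-hasDiamond n (suc (suc e)) (F · (c Fin.zero ∷ 1ℝ ∷ 1ℝ ∷ [])) (c ∘ Fin.suc)
        -- At index zero the bound `2 ℕ.* 0 ℕ.+ suc e` computes to `suc e`.
        (quadratic-hasDiamond e (c Fin.zero) F (0≤c Fin.zero) (c≤ Fin.zero) D)
        (0≤c ∘ Fin.suc)
        (λ i → subst (λ N → c (Fin.suc i) ≤ fromℕ N) (bound (toℕ i) e) (c≤ (Fin.suc i)))))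
  where
  bound : ∀ i e → 2 ℕ.* suc i ℕ.+ suc e ≡ 2 ℕ.* i ℕ.+ suc (suc (suc e))
  bound i e = trans (cong (ℕ._+ suc e) (ℕ.*-suc 2 i)) (sym (+-suc-suc (2 ℕ.* i) (suc e)))

  reassociate : (F · (c Fin.zero ∷ 1ℝ ∷ 1ℝ ∷ [])) · ∏ₚ (quadratic (c ∘ Fin.suc)) ≐ F · ∏ₚ (quadratic c)
  reassociate k m = trans
    (ℚ.*-assoc (seq (F k) m) (seq (eval (c Fin.zero ∷ 1ℝ ∷ 1ℝ ∷ []) (fromℕ k)) m)
      (seq (eval (∏ₚ (quadratic (c ∘ Fin.suc))) (fromℕ k)) m))
    (cong (seq (F k) m ℚ.*_) (trans
      (sym (eval-*ₚ (c Fin.zero ∷ 1ℝ ∷ 1ℝ ∷ []) (∏ₚ (quadratic (c ∘ Fin.suc))) (fromℕ k) m))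
      (cong (λ p → seq (eval p (fromℕ k)) m) (sym (∏ₚ-quadratic c)))))

-- The initial factor b, of degree 0 or 1

constant-hasDiamond : ∀ a → 0ℝ ≤ a → HasDiamond 0 (valueSeries (a ∷ []))
constant-hasDiamond a 0≤a = hasDiamond (IsDiamond-resp-≐ {0} {H} (λ n m → sym (values n m)) record
  { vanishing   = λ { (suc i) _ m → refl }
  ; palindromic = λ { zero zero _ m → refl }
  ; nonNegative = λ { zero → 0≤a ; (suc i) → 0≤fromℕ 0 }
  })
  where
  H : Series
  H zero    = a
  H (suc n) = 0ℝ
  values : ∇^ 1 (valueSeries (a ∷ [])) ≐ H
  values zero    m = solve 1 (λ a → (a :+ con 0ℚ :* con 0ℚ) :- con 0ℚ := a) refl (seq a m)
  values (suc n) m = solve 3 (λ a n₁ n → (a :+ n₁ :* con 0ℚ) :- (a :+ n :* con 0ℚ) := con 0ℚ) refl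
    (seq a m) (ι (suc n)) (ι n)

-- The sum of a (2k + 1) tᵏ over all k is a (1 + t) / (1 - t)².
linear-hasDiamond : ∀ a → 0ℝ ≤ a → HasDiamond 1 (valueSeries ((a ∷ []) *ₚ (1ℝ ∷ fromℕ 2 ∷ [])))
linear-hasDiamond a 0≤a = hasDiamond (IsDiamond-resp-≐ {1} {H} (λ n m → sym (values n m)) record
  { vanishing   = λ { (suc (suc i)) _ m → refl ; (suc zero) (ℕ.s≤s ()) m }
  ; palindromic = λ { zero (suc zero) _ m → refl ; (suc zero) zero _ m → refl }
  ; nonNegative = λ { zero → 0≤a ; (suc zero) → 0≤a ; (suc (suc i)) → 0≤fromℕ 0 }
  })
  where
  H : Series
  H zero          = a
  H (suc zero)    = a
  H (suc (suc n)) = 0ℝ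
  identity : ∀ {n n₁ n₂} → n₁ ≡ 1ℚ ℚ.+ n → n₂ ≡ 1ℚ ℚ.+ n₁ → ∀ a →
    let f = λ z → (a ℚ.* 1ℚ ℚ.+ 0ℚ) ℚ.+ z ℚ.* (a ℚ.* ι 2 ℚ.+ z ℚ.* 0ℚ)
    in (f n₂ ℚ.- f n₁) ℚ.- (f n₁ ℚ.- f n) ≡ 0ℚ
  identity {n} refl refl = solve 2 (λ n a →
    let o = con 1ℚ
        f = λ z → (a :* o :+ con 0ℚ) :+ z :* (a :* con (ι 2) :+ z :* con 0ℚ)
    in (f (o :+ (o :+ n)) :- f (o :+ n)) :- (f (o :+ n) :- f n) := con 0ℚ) refl n
  values : ∇^ 2 (valueSeries ((a ∷ []) *ₚ (1ℝ ∷ fromℕ 2 ∷ []))) ≐ H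
  values zero          m = solve 1 (λ a →
    let z = con 0ℚ
        f = λ x → (a :* con 1ℚ :+ z) :+ x :* (a :* con (ι 2) :+ x :* z)
    in (f z :- z) :- z := a) refl (seq a m)
  values (suc zero)    m = solve 1 (λ a →
    let z = con 0ℚ
        f = λ x → (a :* con 1ℚ :+ z) :+ x :* (a :* con (ι 2) :+ x :* z)
    in (f (con 1ℚ) :- f z) :- (f z :- z) := a) refl (seq a m)
  values (suc (suc n)) m = identity {ι n} {ι (suc n)} {ι (suc (suc n))} (ι-suc n) (ι-suc (suc n)) (seq a m)

-- The two parities of d

degree : Parity → ℕ
degree 0ℙ = 0
degree 1ℙ = 1

⌊d/2⌋*2+degree : ∀ d → ⌊ d /2⌋ ℕ.* 2 ℕ.+ degree (parity d) ≡ d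
⌊d/2⌋*2+degree zero          = refl
⌊d/2⌋*2+degree (suc zero)    = refl
⌊d/2⌋*2+degree (suc (suc d)) = cong (suc ∘ suc) (⌊d/2⌋*2+degree d)

-- Matching on parity d in a goal that mentions reals normalises their Cauchy
-- proofs, hence the two functions of a Parity argument.

cBoundOf : Parity → ℕ → ℝ
cBoundOf 0ℙ i = fromℕ (2 ℕ.* i ℕ.+ 1)
cBoundOf 1ℙ i = fromℕ (2 ℕ.* i ℕ.+ 2)

cBound≡cBoundOf : ∀ d i → cBound d i ≡ cBoundOf (parity d) i
cBound≡cBoundOf d i with parity d
... | 0ℙ = refl
... | 1ℙ = refl

-- Both cases of the bound are one formula, 2i + 1 plus the degree of b, which is the form that the
-- induction over the factors asks for.
cBoundOf≡ : ∀ p i → cBoundOf p i ≡ fromℕ (2 ℕ.* i ℕ.+ suc (degree p))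
cBoundOf≡ 0ℙ i = refl
cBoundOf≡ 1ℙ i = refl

bOf : Parity → ℝ → Poly
bOf 0ℙ a = a ∷ []
bOf 1ℙ a = (a ∷ []) *ₚ (1ℝ ∷ fromℕ 2 ∷ [])

b≡bOf : ∀ d (f : CLPolynomial d) → let open CLPolynomial f in b ≡ bOf (parity d) a
b≡bOf d f with parity d
... | 0ℙ = refl
... | 1ℙ = refl

bOf-hasDiamond : ∀ p a → 0ℝ ≤ a → HasDiamond (degree p) (valueSeries (bOf p a))
bOf-hasDiamond 0ℙ = constant-hasDiamond
bOf-hasDiamond 1ℙ = linear-hasDiamond

-- From difference sequences to h*-vectors

toSeries-tabulate : ∀ k H → (∀ i → k ℕ.≤ i → H i ≋ 0ℝ) →
  toSeries (tabulate {n = k} (H ∘ toℕ)) ≐ H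
toSeries-tabulate zero    H H≋0 n       m = sym (H≋0 n ℕ.z≤n m)
toSeries-tabulate (suc k) H H≋0 zero    m = refl
toSeries-tabulate (suc k) H H≋0 (suc n) m =
  toSeries-tabulate k (H ∘ suc) (λ i k≤i → H≋0 (suc i) (ℕ.s≤s k≤i)) n m

-- The differences are themselves the h*-coefficients, and `vanishing` ensures that truncation to d
-- + 1 entries loses nothing.
HasDiamond⇒Diamond : ∀ d f → HasDiamond d (valueSeries f) → Diamond d f
HasDiamond⇒Diamond d f (hasDiamond D) = record
  { h*          = H ∘ toℕ
  ; isHStar     = λ n → ≋⇒≈
      {(valueSeries f *ₛ toSeries ((1ℝ ∷ - 1ℝ ∷ []) ^ₚ suc d)) n} {toSeries (tabulate {n = suc d} (H ∘ toℕ)) n}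
      (λ m → trans (*ₛ-conv (valueSeries f) (toSeries ((1ℝ ∷ - 1ℝ ∷ []) ^ₚ suc d)) n m)
             (trans (conv-[1-t]^ (suc d) (valueSeries f) n m)
                    (sym (toSeries-tabulate (suc d) H vanishing n m))))
  ; palindromic = λ i → ≋⇒≈ {H (toℕ i)} {H (toℕ (opposite i))} (palindromic (toℕ i) (toℕ (opposite i))
      (trans (cong (toℕ i ℕ.+_) (Fin.opposite-prop i)) (ℕ.m+[n∸m]≡n (Fin.toℕ≤pred[n] i))))
  ; nonNegative = λ i → nonNegative (toℕ i)
  }
  where
  open IsDiamond D
  H = ∇^ (suc d) (valueSeries f)

proposition4p1 : (d : ℕ) (f : CLPolynomial d) →
    let open CLPolynomial f in
    -- Replacing a by -a negates every h*ᵢ, so (♢) can only hold for a > 0.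
    0ℝ ≤ a →
    (∀ i j → i Fin.≤ j → c i ≤ c j) →
    (∀ i → c i ≤ cBound d (toℕ i)) →
    Diamond d poly
proposition4p1 d f 0≤a _ c≤ = HasDiamond⇒Diamond d poly
  (HasDiamond-resp-≐ (valueSeries b · ∏ₚ (quadratic c)) (valueSeries poly)
    (λ k m → sym (eval-*ₚ b (∏ₚ (quadratic c)) (fromℕ k) m))
    -- Starting from the degree of `b`, the induction over the factors ends in twice their number
    -- plus that degree, which is `d`.
    (subst (λ N → HasDiamond N (valueSeries b · ∏ₚ (quadratic c))) (⌊d/2⌋*2+degree d)
      (product-hasDiamond ⌊ d /2⌋ (degree (parity d)) (valueSeries b) c
        (subst (λ p → HasDiamond (degree (parity d)) (valueSeries p)) (sym (b≡bOf d f))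
          (bOf-hasDiamond (parity d) a 0≤a))
        (λ i → ¼≤x⇒0≤x {c i} (¼≤c i))
        (λ i → subst (c i ≤_) (trans (cBound≡cBoundOf d (toℕ i)) (cBoundOf≡ (parity d) (toℕ i))) (c≤ i)))))
  where open CLPolynomial f
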